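{- Let $\Sigma=(G,\sigma)$ be a signed graph. A vector $x\in\mathbb R^{V(\Sigma)}$ belongs to $\mathrm{BTH}(\Sigma)$ if and only if there are real symmetric matrices $M,N$ indexed by $V(\Sigma)$ such that $$\begin{pmatrix} 1 & x^{\mathsf T} \\ x & M \end{pmatrix}\succeq0,\qquad N\succeq0,\qquad M_{vv}=N_{vv}=x_v\quad(v\in V(\Sigma)),$$ and, for every signed edge $e=uv$, $$N_{uv}=\sigma(e)M_{uv}.$$ (If both signs occur between $u$ and $v$, then $M_{uv}=N_{uv}=0$.)
   Context: Signed graphs. A signed graph is a pair $\Sigma=(G,\sigma)$ with $G$ a finite graph and $\sigma:E(G)\to\{+1,-1\}$. Positive loops are allowed, negative loops are excluded; between two distinct vertices there may be both a positive and a negative edge (a digon); repeated edges of the same sign are immaterial. Convention: every signed graph is replaced by its completion having a positive loop at every vertex. Conflict graph. $C(\Sigma)$ is the ordinary simple graph on $V(\Sigma)\times\{\pm1\}$ with $(u,s)\sim(v,r)$ iff there is an edge $e=uv$ of $\Sigma$ (possibly a loop, $u=v$) with $r=-\sigma(e)s$. In particular $(v,+)\sim(v,-)$ for all $v$. Theta body. For a finite simple graph $H$, $\mathrm{TH}(H)=\{x:\exists\, X\text{ symmetric with }\begin{pmatrix} 1 & x^{\mathsf T} \\ x & X \end{pmatrix}\succeq0,\ \operatorname{diag}X=x,\ X_{uv}=0\ (uv\in E(H))\}$. Signed theta body. Let $p:\mathbb R^{V(\Sigma)\times\{\pm1\}}\to\mathbb R^{V(\Sigma)}$, $p(y)_v=y_{(v,+)}+y_{(v,-)}$.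 Then $\mathrm{BTH}(\Sigma)=p(\mathrm{TH}(C(\Sigma)))$. -}

module Defs where

open import Data.List using (List; []; _∷_; foldr; map; _++_; cartesianProduct)
open import Data.List.Membership.Propositional as List using ()
open import Data.List.Membership.Propositional.Properties
  using (∈-map⁺; ∈-map⁻; ∈-++⁺ˡ; ∈-++⁺ʳ; ∈-cartesianProduct⁺)
open import Data.List.Relation.Unary.All as All using (All)
open import Data.List.Relation.Unary.All.Properties as AllP using ()
open import Data.List.Relation.Unary.AllPairs using ([]; _∷_)
open import Data.List.Relation.Unary.Any using (here; there)
open import Data.List.Relation.Unary.Unique.Propositional using (Unique)
open import Data.List.Relation.Unary.Unique.Propositional.Properties as Unique using ()
open import Data.Maybe using (Maybe; just; nothing)
open import Data.Maybe.Properties using (just-injective)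
open import Data.Nat as ℕ using (ℕ)
import Data.Nat.Properties as ℕ
open import Data.Product using (∃-syntax; _×_; _,_; proj₂)
open import Data.Rational as ℚ using (ℚ; 0ℚ; 1ℚ; ½; ∣_∣)
import Data.Rational.Properties as ℚ
open import Data.Rational.Solver using (module +-*-Solver)
open import Data.Sign as Sign using (Sign; opposite)
open import Data.Sum using (_⊎_; inj₁; inj₂; swap)
open import Data.Sum.Properties using (inj₁-injective; inj₂-injective)
open import Level using (0ℓ)
open import Relation.Binary using (Rel; Symmetric)
open import Relation.Binary.PropositionalEquality
  using (_≡_; _≢_; refl; sym; trans; cong; cong₂; subst)
open import Relation.Nullary using (¬_)
open import Relation.Unary using (Pred; _∈_)

-- Reals are Cauchy sequences of rationals, taken up to _≈_. Nothing below
-- depends on how the Cauchy conditions are proved, so those proofs are abstract.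

IsCauchy : (ℕ → ℚ) → Set
IsCauchy a = ∀ ε → 0ℚ ℚ.< ε →
  ∃[ N ] (∀ m n → N ℕ.≤ m → N ℕ.≤ n → ∣ a m ℚ.- a n ∣ ℚ.< ε)

record ℝ : Set where
  constructor mkℝ
  field
    seq    : ℕ → ℚ
    cauchy : IsCauchy seq

open ℝ public

infix 4 _≈_ _≤_

record _≈_ (x y : ℝ) : Set where
  constructor mk≈
  field
    close : ∀ ε → 0ℚ ℚ.< ε →
      ∃[ N ] (∀ n → N ℕ.≤ n → ∣ seq x n ℚ.- seq y n ∣ ℚ.< ε)

record _≤_ (x y : ℝ) : Set where
  constructor mk≤
  field
    below : ∀ ε → 0ℚ ℚ.< ε →
      ∃[ N ] (∀ n → N ℕ.≤ n → seq x n ℚ.< seq y n ℚ.+ ε)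

open _≈_ public
open _≤_ public

fromℚ : ℚ → ℝ
fromℚ q = mkℝ (λ _ → q) λ ε 0<ε →
  0 , λ _ _ _ _ → subst (ℚ._< ε) (sym (cong ∣_∣ (ℚ.+-inverseʳ q))) 0<ε

0ℝ 1ℝ : ℝ
0ℝ = fromℚ 0ℚ
1ℝ = fromℚ 1ℚ

private
  abstract
    ½-pos : ∀ {ε} → 0ℚ ℚ.< ε → 0ℚ ℚ.< ½ ℚ.* ε
    ½-pos 0<ε = ℚ.*-monoʳ-<-pos ½ 0<ε

    ½+½ : ∀ ε → ½ ℚ.* ε ℚ.+ ½ ℚ.* ε ≡ ε
    ½+½ ε = trans (sym (ℚ.*-distribʳ-+ ε ½ ½)) (ℚ.*-identityˡ ε)

    +-cauchy : ∀ a b → IsCauchy a → IsCauchy b → IsCauchy (λ n → a n ℚ.+ b n)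
    +-cauchy a b ca cb ε 0<ε
      with ca (½ ℚ.* ε) (½-pos 0<ε) | cb (½ ℚ.* ε) (½-pos 0<ε)
    ... | N₁ , h₁ | N₂ , h₂ = N₁ ℕ.⊔ N₂ , λ m n N≤m N≤n →
      let open ℚ.≤-Reasoning in begin-strict
        ∣ (a m ℚ.+ b m) ℚ.- (a n ℚ.+ b n) ∣
          ≡⟨ cong ∣_∣ (rearrange (a m) (b m) (a n) (b n)) ⟩
        ∣ (a m ℚ.- a n) ℚ.+ (b m ℚ.- b n) ∣
          ≤⟨ ℚ.∣p+q∣≤∣p∣+∣q∣ (a m ℚ.- a n) (b m ℚ.- b n) ⟩
        ∣ a m ℚ.- a n ∣ ℚ.+ ∣ b m ℚ.- b n ∣
          <⟨ ℚ.+-mono-< (h₁ m n (ℕ.m⊔n≤o⇒m≤o N₁ N₂ N≤m) (ℕ.m⊔n≤o⇒m≤o N₁ N₂ N≤n))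
                        (h₂ m n (ℕ.m⊔n≤o⇒n≤o N₁ N₂ N≤m) (ℕ.m⊔n≤o⇒n≤o N₁ N₂ N≤n)) ⟩
        ½ ℚ.* ε ℚ.+ ½ ℚ.* ε
          ≡⟨ ½+½ ε ⟩
        ε ∎
      where
      open +-*-Solver
      rearrange : ∀ p q r s → (p ℚ.+ q) ℚ.- (r ℚ.+ s) ≡ (p ℚ.- r) ℚ.+ (q ℚ.- s)
      rearrange = solve 4 (λ p q r s → (p :+ q) :- (r :+ s) := (p :- r) :+ (q :- s)) refl

    neg-cauchy : ∀ a → IsCauchy a → IsCauchy (λ n → ℚ.- a n)
    neg-cauchy a ca ε 0<ε with ca ε 0<ε
    ... | N , h = N , λ m n N≤m N≤n →
      subst (ℚ._< ε) (cong ∣_∣ (rearrange (a n) (a m))) (h n m N≤n N≤m)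
      where
      open +-*-Solver
      rearrange : ∀ p q → p ℚ.- q ≡ (ℚ.- q) ℚ.- (ℚ.- p)
      rearrange = solve 2 (λ p q → p :- q := (:- q) :- (:- p)) refl

    bounded : ∀ a → IsCauchy a →
      ∃[ A ] 0ℚ ℚ.< A × ∃[ N ] (∀ n → N ℕ.≤ n → ∣ a n ∣ ℚ.< A)
    bounded a ca with ca 1ℚ (ℚ.positive⁻¹ 1ℚ)
    ... | N , h = 1ℚ ℚ.+ ∣ a N ∣
      , ℚ.+-mono-<-≤ (ℚ.positive⁻¹ 1ℚ) (ℚ.0≤∣p∣ (a N))
      , N , λ n N≤n → let open ℚ.≤-Reasoning in begin-strict
        ∣ a n ∣                           ≡⟨ cong ∣_∣ (rearrange (a n) (a N)) ⟩
        ∣ (a n ℚ.- a N) ℚ.+ a N ∣         ≤⟨ ℚ.∣p+q∣≤∣p∣+∣q∣ (a n ℚ.- a N) (a N) ⟩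
        ∣ a n ℚ.- a N ∣ ℚ.+ ∣ a N ∣       <⟨ ℚ.+-monoˡ-< ∣ a N ∣ (h n N N≤n ℕ.≤-refl) ⟩
        1ℚ ℚ.+ ∣ a N ∣                    ∎
      where
      open +-*-Solver
      rearrange : ∀ p q → p ≡ (p ℚ.- q) ℚ.+ q
      rearrange = solve 2 (λ p q → p := (p :- q) :+ q) refl

    *-small : ∀ {p d A δ} → 0ℚ ℚ.≤ p → p ℚ.< A → d ℚ.< δ → 0ℚ ℚ.< δ →
      p ℚ.* d ℚ.< A ℚ.* δ
    *-small {p} {d} {A} {δ} 0≤p p<A d<δ 0<δ = ℚ.≤-<-trans
      (ℚ.*-monoˡ-≤-nonNeg p ⦃ ℚ.nonNegative 0≤p ⦄ (ℚ.<⇒≤ d<δ))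
      (ℚ.*-monoˡ-<-pos δ ⦃ ℚ.positive 0<δ ⦄ p<A)

    divide : ∀ B ε → 0ℚ ℚ.< B → 0ℚ ℚ.< ε → ∃[ δ ] 0ℚ ℚ.< δ × B ℚ.* δ ≡ ε
    divide B ε 0<B 0<ε = (ℚ.1/ B) ℚ.* ε
      , subst (ℚ._< (ℚ.1/ B) ℚ.* ε) (ℚ.*-zeroʳ (ℚ.1/ B))
          (ℚ.*-monoʳ-<-pos (ℚ.1/ B) 0<ε)
      , trans (sym (ℚ.*-assoc B (ℚ.1/ B) ε))
          (trans (cong (ℚ._* ε) (ℚ.*-inverseʳ B)) (ℚ.*-identityˡ ε))
      where
      instance
        B⁺ : ℚ.Positive B
        B⁺ = ℚ.positive 0<B
        B≠0 : ℚ.NonZero B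
        B≠0 = ℚ.pos⇒nonZero B
        B⁻¹⁺ : ℚ.Positive (ℚ.1/ B)
        B⁻¹⁺ = ℚ.1/pos⇒pos B

    *-close : ∀ p q r s {A B δ} → 0ℚ ℚ.< δ → ∣ p ∣ ℚ.< A → ∣ s ∣ ℚ.< B →
      ∣ p ℚ.- r ∣ ℚ.< δ → ∣ q ℚ.- s ∣ ℚ.< δ →
      ∣ p ℚ.* q ℚ.- r ℚ.* s ∣ ℚ.< (A ℚ.+ B) ℚ.* δ
    *-close p q r s {A} {B} {δ} 0<δ p<A s<B pr<δ qs<δ = begin-strict
      ∣ p ℚ.* q ℚ.- r ℚ.* s ∣
        ≡⟨ cong ∣_∣ (rearrange p q r s) ⟩
      ∣ p ℚ.* (q ℚ.- s) ℚ.+ s ℚ.* (p ℚ.- r) ∣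
        ≤⟨ ℚ.∣p+q∣≤∣p∣+∣q∣ (p ℚ.* (q ℚ.- s)) (s ℚ.* (p ℚ.- r)) ⟩
      ∣ p ℚ.* (q ℚ.- s) ∣ ℚ.+ ∣ s ℚ.* (p ℚ.- r) ∣
        ≡⟨ cong₂ ℚ._+_ (ℚ.∣p*q∣≡∣p∣*∣q∣ p (q ℚ.- s)) (ℚ.∣p*q∣≡∣p∣*∣q∣ s (p ℚ.- r)) ⟩
      ∣ p ∣ ℚ.* ∣ q ℚ.- s ∣ ℚ.+ ∣ s ∣ ℚ.* ∣ p ℚ.- r ∣
        <⟨ ℚ.+-mono-<
             {∣ p ∣ ℚ.* ∣ q ℚ.- s ∣} {A ℚ.* δ} {∣ s ∣ ℚ.* ∣ p ℚ.- r ∣} {B ℚ.* δ}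
             (*-small {∣ p ∣} {∣ q ℚ.- s ∣} {A} {δ} (ℚ.0≤∣p∣ p) p<A qs<δ 0<δ)
             (*-small {∣ s ∣} {∣ p ℚ.- r ∣} {B} {δ} (ℚ.0≤∣p∣ s) s<B pr<δ 0<δ) ⟩
      A ℚ.* δ ℚ.+ B ℚ.* δ
        ≡⟨ sym (ℚ.*-distribʳ-+ δ A B) ⟩
      (A ℚ.+ B) ℚ.* δ ∎
      where
      open ℚ.≤-Reasoning
      rearrange : ∀ p q r s →
        p ℚ.* q ℚ.- r ℚ.* s ≡ p ℚ.* (q ℚ.- s) ℚ.+ s ℚ.* (p ℚ.- r)
      rearrange = solve 4
        (λ p q r s → p :* q :- r :* s := p :* (q :- s) :+ s :* (p :- r)) refl
        where open +-*-Solver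

    *-cauchy : ∀ a b → IsCauchy a → IsCauchy b → IsCauchy (λ n → a n ℚ.* b n)
    *-cauchy a b ca cb ε 0<ε =
      let A , 0<A , K₁ , k₁ = bounded a ca
          B , 0<B , K₂ , k₂ = bounded b cb
          δ , 0<δ , eq = divide (A ℚ.+ B) ε (ℚ.+-mono-< 0<A 0<B) 0<ε
          N₁ , h₁ = ca δ 0<δ
          N₂ , h₂ = cb δ 0<δ
          K = K₁ ℕ.⊔ K₂
          N = N₁ ℕ.⊔ N₂
      in K ℕ.⊔ N , λ m n ≤m ≤n →
        let K≤m = ℕ.m⊔n≤o⇒m≤o K N ≤m
            K≤n = ℕ.m⊔n≤o⇒m≤o K N ≤n
            N≤m = ℕ.m⊔n≤o⇒n≤o K N ≤m
            N≤n = ℕ.m⊔n≤o⇒n≤o K N ≤n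
        in subst (∣ a m ℚ.* b m ℚ.- a n ℚ.* b n ∣ ℚ.<_) eq
             (*-close (a m) (b m) (a n) (b n) {A} {B} {δ} 0<δ
               (k₁ m (ℕ.m⊔n≤o⇒m≤o K₁ K₂ K≤m))
               (k₂ n (ℕ.m⊔n≤o⇒n≤o K₁ K₂ K≤n))
               (h₁ m n (ℕ.m⊔n≤o⇒m≤o N₁ N₂ N≤m) (ℕ.m⊔n≤o⇒m≤o N₁ N₂ N≤n))
               (h₂ m n (ℕ.m⊔n≤o⇒n≤o N₁ N₂ N≤m) (ℕ.m⊔n≤o⇒n≤o N₁ N₂ N≤n)))

infixl 6 _+_
infixl 7 _*_
infix  8 -_

_+_ : ℝ → ℝ → ℝ
x + y = mkℝ (λ n → seq x n ℚ.+ seq y n) (+-cauchy (seq x) (seq y) (cauchy x) (cauchy y))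

_*_ : ℝ → ℝ → ℝ
x * y = mkℝ (λ n → seq x n ℚ.* seq y n) (*-cauchy (seq x) (seq y) (cauchy x) (cauchy y))

-_ : ℝ → ℝ
- x = mkℝ (λ n → ℚ.- seq x n) (neg-cauchy (seq x) (cauchy x))

⟦_⟧ : Sign → ℝ
⟦ Sign.+ ⟧ = 1ℝ
⟦ Sign.- ⟧ = - 1ℝ

record Finite (A : Set) : Set where
  field
    elements : List A
    complete : ∀ a → a List.∈ elements
    unique   : Unique elements

open Finite public

finiteMaybe : ∀ {A} → Finite A → Finite (Maybe A)
finiteMaybe F .elements = nothing ∷ map just (elements F)
finiteMaybe F .complete nothing  = here refl
finiteMaybe F .complete (just a) = there (∈-map⁺ just (complete F a))
finiteMaybe F .unique =
  AllP.map⁺ (All.universal (λ _ ()) (elements F))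
  ∷ Unique.map⁺ just-injective (unique F)

finiteSign : Finite Sign
finiteSign .elements = Sign.+ ∷ Sign.- ∷ []
finiteSign .complete Sign.+ = here refl
finiteSign .complete Sign.- = there (here refl)
finiteSign .unique = ((λ ()) All.∷ All.[]) ∷ All.[] ∷ []

finite× : ∀ {A B} → Finite A → Finite B → Finite (A × B)
finite× F G .elements = cartesianProduct (elements F) (elements G)
finite× F G .complete (a , b) = ∈-cartesianProduct⁺ (complete F a) (complete G b)
finite× F G .unique = Unique.cartesianProduct⁺ (unique F) (unique G)

finite⊎ : ∀ {A B} → Finite A → Finite B → Finite (A ⊎ B)
finite⊎ F G .elements = map inj₁ (elements F) ++ map inj₂ (elements G)
finite⊎ F G .complete (inj₁ a) = ∈-++⁺ˡ (∈-map⁺ inj₁ (complete F a))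
finite⊎ F G .complete (inj₂ b) =
  ∈-++⁺ʳ (map inj₁ (elements F)) (∈-map⁺ inj₂ (complete G b))
finite⊎ F G .unique = Unique.++⁺
  (Unique.map⁺ inj₁-injective (unique F))
  (Unique.map⁺ inj₂-injective (unique G))
  λ (i , j) → inj₁≢inj₂ (proj₂ (proj₂ (∈-map⁻ inj₁ i))) (proj₂ (proj₂ (∈-map⁻ inj₂ j)))
  where
  inj₁≢inj₂ : ∀ {A B : Set} {c : A ⊎ B} {a b} → c ≡ inj₁ a → ¬ (c ≡ inj₂ b)
  inj₁≢inj₂ refl ()

∑ : ∀ {I} → Finite I → (I → ℝ) → ℝ
∑ F f = foldr _+_ 0ℝ (map f (elements F))

Vector : Set → Set
Vector I = I → ℝ

Matrix : Set → Set
Matrix I = I → I → ℝ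

IsSymmetric : ∀ {I} → Matrix I → Set
IsSymmetric A = ∀ i j → A i j ≈ A j i

IsPSD : ∀ {I} → Finite I → Matrix I → Set
IsPSD {I} F A = IsSymmetric A
  × (∀ (z : Vector I) → 0ℝ ≤ ∑ F (λ i → ∑ F (λ j → z i * A i j * z j)))

-- The block matrix with rows (1 , xᵀ) and (x , X); the index `nothing` is the
-- added first row and column.
bordered : ∀ {I} → Vector I → Matrix I → Matrix (Maybe I)
bordered x X nothing  nothing  = 1ℝ
bordered x X nothing  (just j) = x j
bordered x X (just i) nothing  = x i
bordered x X (just i) (just j) = X i j

record SimpleGraph : Set₁ where
  field
    Vertex      : Set
    finite      : Finite Vertex
    Adjacent    : Rel Vertex 0ℓ
    symmetric   : Symmetric Adjacent
    irreflexive : ∀ {v} → ¬ Adjacent v v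

TH : (H : SimpleGraph) → Pred (Vector (SimpleGraph.Vertex H)) 0ℓ
TH H x = ∃[ X ] IsSymmetric X
  × IsPSD (finiteMaybe finite) (bordered x X)
  × (∀ v → X v v ≈ x v)
  × (∀ u v → Adjacent u v → X u v ≈ 0ℝ)
  where open SimpleGraph H

-- Edges are undirected: the order of `source` and `target` carries no meaning,
-- and edges are only used through the relation `Joins`.
record SignedGraph : Set₁ where
  field
    Vertex         : Set
    finiteVertex   : Finite Vertex
    Edge           : Set
    finiteEdge     : Finite Edge
    source target  : Edge → Vertex
    σ              : Edge → Sign
    noNegativeLoop : ∀ e → σ e ≡ Sign.- → source e ≢ target e

  Joins : Edge → Vertex → Vertex → Set
  Joins e u v = (source e ≡ u × target e ≡ v) ⊎ (source e ≡ v × target e ≡ u)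

-- Adds a new positive loop at every vertex; a loop that was already there is
-- merely repeated.
completion : SignedGraph → SignedGraph
completion S = record
  { Vertex         = Vertex
  ; finiteVertex   = finiteVertex
  ; Edge           = Edge ⊎ Vertex
  ; finiteEdge     = finite⊎ finiteEdge finiteVertex
  ; source         = λ { (inj₁ e) → source e ; (inj₂ v) → v }
  ; target         = λ { (inj₁ e) → target e ; (inj₂ v) → v }
  ; σ              = λ { (inj₁ e) → σ e ; (inj₂ _) → Sign.+ }
  ; noNegativeLoop = λ { (inj₁ e) → noNegativeLoop e ; (inj₂ _) () }
  }
  where open SignedGraph S

conflictGraph : SignedGraph → SimpleGraph
conflictGraph S = record
  { Vertex      = Vertex × Sign
  ; finite      = finite× finiteVertex finiteSign
  ; Adjacent    = λ (u , s) (v , r) →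
      ∃[ e ] Joins e u v × r ≡ opposite (σ e) Sign.* s
  ; symmetric   = λ (e , J , eq) → e , swap J , flip (σ e) eq
  ; irreflexive = λ (e , J , eq) →
      noNegativeLoop e (negative (σ e) eq) (loop J)
  }
  where
  open SignedGraph S
  flip : ∀ t {s r} → r ≡ opposite t Sign.* s → s ≡ opposite t Sign.* r
  flip Sign.+ {Sign.+} refl = refl
  flip Sign.+ {Sign.-} refl = refl
  flip Sign.- refl = refl
  negative : ∀ t {s} → s ≡ opposite t Sign.* s → t ≡ Sign.-
  negative Sign.- _ = refl
  negative Sign.+ {Sign.+} ()
  negative Sign.+ {Sign.-} ()
  loop : ∀ {e v} → Joins e v v → source e ≡ target e
  loop (inj₁ (p , q)) = trans p (sym q)
  loop (inj₂ (p , q)) = trans p (sym q)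

foldSigns : ∀ {V : Set} → Vector (V × Sign) → Vector V
foldSigns y v = y (v , Sign.+) + y (v , Sign.-)

BTH : (S : SignedGraph) → Pred (Vector (SignedGraph.Vertex S)) 0ℓ
BTH S x = ∃[ y ] y ∈ TH (conflictGraph S) × (∀ v → foldSigns y v ≈ x v)

record IsCertificate (S : SignedGraph) (x : Vector (SignedGraph.Vertex S))
                     (M N : Matrix (SignedGraph.Vertex S)) : Set where
  open SignedGraph S
  field
    M-symmetric  : IsSymmetric M
    N-symmetric  : IsSymmetric N
    M-psd        : IsPSD (finiteMaybe finiteVertex) (bordered x M)
    N-psd        : IsPSD finiteVertex N
    M-diagonal   : ∀ v → M v v ≈ x v
    N-diagonal   : ∀ v → N v v ≈ x v
    edgeRelation : ∀ e u v → Joins e u v → N u v ≈ ⟦ σ e ⟧ * M u v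

Digon : (S : SignedGraph) → Rel (SignedGraph.Vertex S) 0ℓ
Digon S u v = (∃[ e ] Joins e u v × σ e ≡ Sign.+) × (∃[ f ] Joins f u v × σ f ≡ Sign.-)
  where open SignedGraph S

{-# OPTIONS --safe #-}
-- Block-diagonalise the sign: for each pair of vertices, the 2×2 block of X on
-- {u} × {±} and {v} × {±} is rotated to the basis (1,1), (1,-1). The symmetric
-- part M u v = Σ X(u,s)(v,r) and the antisymmetric part
-- N u v = Σ s r X(u,s)(v,r) are then the certificate; conversely
-- X(u,s)(v,r) = ¼ (M u v + s r N u v) with y(v,s) = ½ x v, whose bordered form at
-- z is that of M at ½ (z₊ + z₋) plus that of N at ½ (z₊ - z₋). The conflict edges
-- say that r = - σ s kills X(u,s)(v,r), which is exactly N = σ M.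
module Submission where

open import Defs
open import Data.List using (List; []; _∷_; foldr; map; cartesianProduct)
open import Data.List.Properties using (map-∘)
open import Data.Maybe using (Maybe; just; nothing)
import Data.Nat as ℕ
import Data.Nat.Properties as ℕ
open import Data.Product using (_×_; _,_; proj₂; ∃-syntax)
open import Data.Rational as ℚ using (ℚ; 0ℚ; 1ℚ; ½; ∣_∣)
import Data.Rational.Properties as ℚ
open import Data.Rational.Solver using (module +-*-Solver)
open import Data.Sign as Sign using (Sign; opposite)
import Data.Sign.Properties as Sign
open import Data.Sum using (inj₁; inj₂)
open import Function using (_∘_)
open import Function.Bundles using (_⇔_; mk⇔)
open import Level using (0ℓ)
open import Relation.Binary using (Setoid)
open import Relation.Binary.PropositionalEquality
  using (_≡_; refl; sym; trans; cong; subst)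
import Relation.Binary.Reasoning.Setoid
open import Relation.Unary using (_∈_)
open +-*-Solver using (solve; _:=_; _:+_; _:*_; _:-_; :-_; con)

-- Equality and order of Cauchy reals

½-pos : ∀ {ε} → 0ℚ ℚ.< ε → 0ℚ ℚ.< ½ ℚ.* ε
½-pos = ℚ.*-monoʳ-<-pos ½

½+½ : ∀ ε → ½ ℚ.* ε ℚ.+ ½ ℚ.* ε ≡ ε
½+½ = solve 1 (λ ε → con ½ :* ε :+ con ½ :* ε := ε) refl

p≤∣p∣ : ∀ p → p ℚ.≤ ∣ p ∣
p≤∣p∣ p with ℚ.≤-total 0ℚ p
... | inj₁ 0≤p = ℚ.≤-reflexive (sym (ℚ.0≤p⇒∣p∣≡p 0≤p))
... | inj₂ p≤0 = ℚ.≤-trans p≤0 (ℚ.0≤∣p∣ p)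

-- Arithmetic acts termwise on sequences, so a polynomial identity over the reals follows from the
-- same identity over `ℚ` at each index, where the ring solver applies.
pointwise : ∀ {x y} → (∀ n → seq x n ≡ seq y n) → x ≈ y
pointwise {x} {y} eq = mk≈ λ ε 0<ε → 0 , λ n _ →
  subst (ℚ._< ε) (sym (trans (cong (λ q → ∣ q ℚ.- seq y n ∣) (eq n))
                             (cong ∣_∣ (ℚ.+-inverseʳ (seq y n))))) 0<ε

≈-refl : ∀ {x} → x ≈ x
≈-refl = pointwise λ _ → refl

≈-sym : ∀ {x y} → x ≈ y → y ≈ x
≈-sym {x} {y} x≈y = mk≈ λ ε 0<ε → let N , h = close x≈y ε 0<ε in
  N , λ n N≤n → subst (ℚ._< ε)
    (trans (sym (ℚ.∣-p∣≡∣p∣ (seq x n ℚ.- seq y n)))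
           (cong ∣_∣ (flip (seq x n) (seq y n))))
    (h n N≤n)
  where
  flip : ∀ p q → ℚ.- (p ℚ.- q) ≡ q ℚ.- p
  flip = solve 2 (λ p q → :- (p :- q) := q :- p) refl

∣p+q∣<ε : ∀ {p q ε} → ∣ p ∣ ℚ.< ½ ℚ.* ε → ∣ q ∣ ℚ.< ½ ℚ.* ε → ∣ p ℚ.+ q ∣ ℚ.< ε
∣p+q∣<ε {p} {q} {ε} p< q< = ℚ.≤-<-trans (ℚ.∣p+q∣≤∣p∣+∣q∣ p q)
  (subst (∣ p ∣ ℚ.+ ∣ q ∣ ℚ.<_) (½+½ ε) (ℚ.+-mono-< p< q<))

≈-trans : ∀ {x y z} → x ≈ y → y ≈ z → x ≈ z
≈-trans {x} {y} {z} x≈y y≈z = mk≈ λ ε 0<ε →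
  let N₁ , h₁ = close x≈y (½ ℚ.* ε) (½-pos 0<ε)
      N₂ , h₂ = close y≈z (½ ℚ.* ε) (½-pos 0<ε)
  in N₁ ℕ.⊔ N₂ , λ n ≤n → subst (λ q → ∣ q ∣ ℚ.< ε)
    (telescope (seq x n) (seq y n) (seq z n))
    (∣p+q∣<ε {ε = ε} (h₁ n (ℕ.m⊔n≤o⇒m≤o N₁ N₂ ≤n)) (h₂ n (ℕ.m⊔n≤o⇒n≤o N₁ N₂ ≤n)))
  where
  telescope : ∀ p q r → (p ℚ.- q) ℚ.+ (q ℚ.- r) ≡ p ℚ.- r
  telescope = solve 3 (λ p q r → (p :- q) :+ (q :- r) := p :- r) refl

≈-setoid : Setoid 0ℓ 0ℓ
≈-setoid = record
  { Carrier       = ℝ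
  ; _≈_           = _≈_
  ; isEquivalence = record { refl = ≈-refl ; sym = ≈-sym ; trans = ≈-trans }
  }

+-cong : ∀ {x y u v} → x ≈ y → u ≈ v → x + u ≈ y + v
+-cong {x} {y} {u} {v} x≈y u≈v = mk≈ λ ε 0<ε →
  let N₁ , h₁ = close x≈y (½ ℚ.* ε) (½-pos 0<ε)
      N₂ , h₂ = close u≈v (½ ℚ.* ε) (½-pos 0<ε)
  in N₁ ℕ.⊔ N₂ , λ n ≤n → subst (λ q → ∣ q ∣ ℚ.< ε)
    (rearrange (seq x n) (seq y n) (seq u n) (seq v n))
    (∣p+q∣<ε {ε = ε} (h₁ n (ℕ.m⊔n≤o⇒m≤o N₁ N₂ ≤n)) (h₂ n (ℕ.m⊔n≤o⇒n≤o N₁ N₂ ≤n)))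
  where
  rearrange : ∀ p q r s → (p ℚ.- q) ℚ.+ (r ℚ.- s) ≡ (p ℚ.+ r) ℚ.- (q ℚ.+ s)
  rearrange = solve 4 (λ p q r s → (p :- q) :+ (r :- s) := (p :+ r) :- (q :+ s)) refl

-- Abstract, as conversion checking would otherwise unfold the rational arithmetic.
abstract
  eventuallyBounded : ∀ x → ∃[ A ] 0ℚ ℚ.< A × ∃[ N ] (∀ n → N ℕ.≤ n → ∣ seq x n ∣ ℚ.≤ A)
  eventuallyBounded x =
    let N , h = cauchy x 1ℚ (ℚ.positive⁻¹ 1ℚ)
        a     = seq x
    -- From `N` on, every term lies within 1 of `a N`.
    in 1ℚ ℚ.+ ∣ a N ∣
     , ℚ.+-mono-<-≤ (ℚ.positive⁻¹ 1ℚ) (ℚ.0≤∣p∣ (a N))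
     , N , λ n N≤n → subst (λ q → ∣ q ∣ ℚ.≤ 1ℚ ℚ.+ ∣ a N ∣) (cancel (a n) (a N))
         (ℚ.≤-trans (ℚ.∣p+q∣≤∣p∣+∣q∣ (a n ℚ.- a N) (a N))
                    (ℚ.+-monoˡ-≤ ∣ a N ∣ (ℚ.<⇒≤ (h n N N≤n ℕ.≤-refl))))
    where
    cancel : ∀ p q → (p ℚ.- q) ℚ.+ q ≡ p
    cancel = solve 2 (λ p q → (p :- q) :+ q := p) refl

  divide : ∀ B ε → 0ℚ ℚ.< B → 0ℚ ℚ.< ε → ∃[ δ ] 0ℚ ℚ.< δ × B ℚ.* δ ≡ ε
  divide B ε 0<B 0<ε = (ℚ.1/ B) ℚ.* ε
    , subst (ℚ._< (ℚ.1/ B) ℚ.* ε) (ℚ.*-zeroʳ (ℚ.1/ B)) (ℚ.*-monoʳ-<-pos (ℚ.1/ B) 0<ε)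
    , trans (sym (ℚ.*-assoc B (ℚ.1/ B) ε))
        (trans (cong (ℚ._* ε) (ℚ.*-inverseʳ B)) (ℚ.*-identityˡ ε))
    where
    instance
      B⁺ : ℚ.Positive B
      B⁺ = ℚ.positive 0<B
      B≠0 : ℚ.NonZero B
      B≠0 = ℚ.pos⇒nonZero B
      B⁻¹⁺ : ℚ.Positive (ℚ.1/ B)
      B⁻¹⁺ = ℚ.1/pos⇒pos B

∣p*q-p*r∣<A*δ : ∀ A .⦃ _ : ℚ.Positive A ⦄ p q r {δ} →
  ∣ p ∣ ℚ.≤ A → ∣ q ℚ.- r ∣ ℚ.< δ → ∣ p ℚ.* q ℚ.- p ℚ.* r ∣ ℚ.< A ℚ.* δ
∣p*q-p*r∣<A*δ A p q r {δ} p≤A d<δ = begin-strict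
  ∣ p ℚ.* q ℚ.- p ℚ.* r ∣   ≡⟨ cong ∣_∣ (factor p q r) ⟩
  ∣ p ℚ.* d ∣               ≡⟨ ℚ.∣p*q∣≡∣p∣*∣q∣ p d ⟩
  ∣ p ∣ ℚ.* ∣ d ∣           ≤⟨ ℚ.*-monoʳ-≤-nonNeg ∣ d ∣ ⦃ ∣d∣-nonNeg ⦄ {∣ p ∣} {A} p≤A ⟩
  A ℚ.* ∣ d ∣               <⟨ ℚ.*-monoʳ-<-pos A {∣ d ∣} {δ} d<δ ⟩
  A ℚ.* δ                   ∎
  where
  open ℚ.≤-Reasoning
  d = q ℚ.- r
  ∣d∣-nonNeg = ℚ.nonNegative (ℚ.0≤∣p∣ d)
  factor : ∀ p q r → p ℚ.* q ℚ.- p ℚ.* r ≡ p ℚ.* (q ℚ.- r)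
  factor = solve 3 (λ p q r → p :* q :- p :* r := p :* (q :- r)) refl

-- A tail of `z` is bounded by some `A > 0`, so precision `δ = ε / A` between `x` and `y` is enough
-- after multiplication.
*-congˡ : ∀ z {x y} → x ≈ y → z * x ≈ z * y
*-congˡ z {x} {y} x≈y = mk≈ λ ε 0<ε →
  let A , 0<A , N₁ , bound = eventuallyBounded z
      δ , 0<δ , Aδ≡ε       = divide A ε 0<A 0<ε
      N₂ , h               = close x≈y δ 0<δ
  in N₁ ℕ.⊔ N₂ , λ n ≤n →
    subst (∣ seq z n ℚ.* seq x n ℚ.- seq z n ℚ.* seq y n ∣ ℚ.<_) Aδ≡ε
      (∣p*q-p*r∣<A*δ A ⦃ ℚ.positive 0<A ⦄ (seq z n) (seq x n) (seq y n) {δ}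
        (bound n (ℕ.m⊔n≤o⇒m≤o N₁ N₂ ≤n)) (h n (ℕ.m⊔n≤o⇒n≤o N₁ N₂ ≤n)))

-- Half of the slack `ε` pays for the inequality and half for the equality. Every semidefiniteness
-- proof below ends here: a form known to be nonnegative is identified with the form in question.
≤-respʳ-≈ : ∀ {x y z} → y ≈ z → x ≤ y → x ≤ z
≤-respʳ-≈ {x} {y} {z} y≈z x≤y = mk≤ λ ε 0<ε →
  let δ       = ½ ℚ.* ε
      N₁ , h₁ = close y≈z δ (½-pos 0<ε)
      N₂ , h₂ = below x≤y δ (½-pos 0<ε)
  in N₁ ℕ.⊔ N₂ , λ n ≤n →
    let a = seq x n ; b = seq y n ; c = seq z n
        open ℚ.≤-Reasoning
    in begin-strict
      a
        <⟨ h₂ n (ℕ.m⊔n≤o⇒n≤o N₁ N₂ ≤n) ⟩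
      b ℚ.+ δ
        ≡⟨ split b c δ ⟩
      (b ℚ.- c) ℚ.+ (c ℚ.+ δ)
        ≤⟨ ℚ.+-monoˡ-≤ (c ℚ.+ δ) {b ℚ.- c} {∣ b ℚ.- c ∣} (p≤∣p∣ (b ℚ.- c)) ⟩
      ∣ b ℚ.- c ∣ ℚ.+ (c ℚ.+ δ)
        <⟨ ℚ.+-monoˡ-< (c ℚ.+ δ) {∣ b ℚ.- c ∣} {δ} (h₁ n (ℕ.m⊔n≤o⇒m≤o N₁ N₂ ≤n)) ⟩
      δ ℚ.+ (c ℚ.+ δ)
        ≡⟨ swap δ c ⟩
      c ℚ.+ (δ ℚ.+ δ)
        ≡⟨ cong (c ℚ.+_) (½+½ ε) ⟩
      c ℚ.+ ε ∎
  where
  split : ∀ b c δ → b ℚ.+ δ ≡ (b ℚ.- c) ℚ.+ (c ℚ.+ δ)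
  split = solve 3 (λ b c δ → b :+ δ := (b :- c) :+ (c :+ δ)) refl
  swap : ∀ δ c → δ ℚ.+ (c ℚ.+ δ) ≡ c ℚ.+ (δ ℚ.+ δ)
  swap = solve 2 (λ δ c → δ :+ (c :+ δ) := c :+ (δ :+ δ)) refl

0≤+ : ∀ {x y} → 0ℝ ≤ x → 0ℝ ≤ y → 0ℝ ≤ x + y
0≤+ {x} {y} 0≤x 0≤y = mk≤ λ ε 0<ε →
  let δ       = ½ ℚ.* ε
      N₁ , h₁ = below 0≤x δ (½-pos 0<ε)
      N₂ , h₂ = below 0≤y δ (½-pos 0<ε)
  in N₁ ℕ.⊔ N₂ , λ n ≤n →
    let a = seq x n ; b = seq y n
        open ℚ.≤-Reasoning
    in begin-strict
      0ℚ
        <⟨ ℚ.+-mono-< {0ℚ} {a ℚ.+ δ} {0ℚ} {b ℚ.+ δ}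
             (h₁ n (ℕ.m⊔n≤o⇒m≤o N₁ N₂ ≤n)) (h₂ n (ℕ.m⊔n≤o⇒n≤o N₁ N₂ ≤n)) ⟩
      (a ℚ.+ δ) ℚ.+ (b ℚ.+ δ)
        ≡⟨ interchange a b δ ⟩
      (a ℚ.+ b) ℚ.+ (δ ℚ.+ δ)
        ≡⟨ cong ((a ℚ.+ b) ℚ.+_) (½+½ ε) ⟩
      (a ℚ.+ b) ℚ.+ ε ∎
  where
  interchange : ∀ a b δ → (a ℚ.+ δ) ℚ.+ (b ℚ.+ δ) ≡ (a ℚ.+ b) ℚ.+ (δ ℚ.+ δ)
  interchange = solve 3
    (λ a b δ → (a :+ δ) :+ (b :+ δ) := (a :+ b) :+ (δ :+ δ)) refl

open Relation.Binary.Reasoning.Setoid ≈-setoid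

-- Arithmetic laws up to `≈`

*-congʳ : ∀ z {x y} → x ≈ y → x * z ≈ y * z
*-congʳ z {x} {y} x≈y = begin
  x * z  ≈⟨ pointwise (λ n → ℚ.*-comm (seq x n) (seq z n)) ⟩
  z * x  ≈⟨ *-congˡ z x≈y ⟩
  z * y  ≈⟨ pointwise (λ n → ℚ.*-comm (seq z n) (seq y n)) ⟩
  y * z  ∎

+-interchange : ∀ a b c d → (a + b) + (c + d) ≈ (a + c) + (b + d)
+-interchange a b c d = pointwise λ n → solve 4
  (λ a b c d → (a :+ b) :+ (c :+ d) := (a :+ c) :+ (b :+ d)) refl
  (seq a n) (seq b n) (seq c n) (seq d n)

+-assoc : ∀ a b c → (a + b) + c ≈ a + (b + c)
+-assoc a b c = pointwise λ n → ℚ.+-assoc (seq a n) (seq b n) (seq c n)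

+-identityˡ : ∀ a → 0ℝ + a ≈ a
+-identityˡ a = pointwise λ n → ℚ.+-identityˡ (seq a n)

+-identityʳ : ∀ a → a + 0ℝ ≈ a
+-identityʳ a = pointwise λ n → ℚ.+-identityʳ (seq a n)

*-identityˡ : ∀ a → 1ℝ * a ≈ a
*-identityˡ a = pointwise λ n → ℚ.*-identityˡ (seq a n)

-- Finite sums

∑-cong : ∀ {I} (F : Finite I) {f g : I → ℝ} → (∀ i → f i ≈ g i) → ∑ F f ≈ ∑ F g
∑-cong {I} F {f} {g} f≈g = go (elements F)
  where
  go : (is : List I) → foldr _+_ 0ℝ (map f is) ≈ foldr _+_ 0ℝ (map g is)
  go []       = ≈-refl
  go (i ∷ is) = +-cong (f≈g i) (go is)

∑-+ : ∀ {I} (F : Finite I) (f g : I → ℝ) → ∑ F (λ i → f i + g i) ≈ ∑ F f + ∑ F g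
∑-+ {I} F f g = go (elements F)
  where
  go : (is : List I) → foldr _+_ 0ℝ (map (λ i → f i + g i) is)
                     ≈ foldr _+_ 0ℝ (map f is) + foldr _+_ 0ℝ (map g is)
  go []       = ≈-sym (+-identityˡ 0ℝ)
  go (i ∷ is) = ≈-trans (+-cong ≈-refl (go is)) (+-interchange (f i) (g i) _ _)

∑-zero : ∀ {I} (F : Finite I) {f : I → ℝ} → (∀ i → f i ≈ 0ℝ) → ∑ F f ≈ 0ℝ
∑-zero {I} F {f} f≈0 = go (elements F)
  where
  go : (is : List I) → foldr _+_ 0ℝ (map f is) ≈ 0ℝ
  go []       = ≈-refl
  go (i ∷ is) = ≈-trans (+-cong (f≈0 i) (go is)) (+-identityˡ 0ℝ)

∑-maybe : ∀ {I} (F : Finite I) (f : Maybe I → ℝ) →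
  ∑ (finiteMaybe F) f ≡ f nothing + ∑ F (f ∘ just)
∑-maybe F f = cong (λ l → f nothing + foldr _+_ 0ℝ l) (sym (map-∘ (elements F)))

-- The product enumeration lists `(i , +)` and `(i , -)` consecutively, so reassociating the sum
-- suffices.
∑-sign : ∀ {I} (F : Finite I) (f : I × Sign → ℝ) →
  ∑ (finite× F finiteSign) f ≈ ∑ F (λ i → f (i , Sign.+) + f (i , Sign.-))
∑-sign {I} F f = go (elements F)
  where
  go : (is : List I) →
    foldr _+_ 0ℝ (map f (cartesianProduct is (elements finiteSign)))
    ≈ foldr _+_ 0ℝ (map (λ i → f (i , Sign.+) + f (i , Sign.-)) is)
  go []       = ≈-refl
  go (i ∷ is) = ≈-trans (≈-sym (+-assoc (f (i , Sign.+)) (f (i , Sign.-)) _))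
                        (+-cong ≈-refl (go is))

-- Quadratic forms

quad : ∀ {I} → Finite I → Matrix I → Vector I → ℝ
quad F A z = ∑ F λ i → ∑ F λ j → z i * A i j * z j

-- The contribution of the border row and the border column, each product in the order in which
-- `quad` produces it.
cross : ∀ {I} → Finite I → ℝ → Vector I → Vector I → ℝ
cross F z₀ x z = ∑ F λ i → z₀ * x i * z i + z i * x i * z₀

-- Splitting both sums at `nothing` separates the corner, the border and the inner form. Bordered
-- forms can then be compared one summand at a time.
quad-bordered : ∀ {I} (F : Finite I) x X (z : Vector (Maybe I)) →
  quad (finiteMaybe F) (bordered x X) z
  ≈ (z nothing * 1ℝ * z nothing + cross F (z nothing) x (z ∘ just)) + quad F X (z ∘ just)
quad-bordered F x X z = begin
  quad (finiteMaybe F) (bordered x X) z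
    ≡⟨ ∑-maybe F row ⟩
  row nothing + ∑ F (row ∘ just)
    ≈⟨ +-cong (≡⇒≈ (∑-maybe F _)) (∑-cong F λ i → ≡⇒≈ (∑-maybe F _)) ⟩
  (z₀ * 1ℝ * z₀ + ∑ F right) + ∑ F (λ i → left i + inner i)
    ≈⟨ +-cong ≈-refl (∑-+ F left inner) ⟩
  (z₀ * 1ℝ * z₀ + ∑ F right) + (∑ F left + ∑ F inner)
    ≈⟨ +-assoc _ (∑ F left) (∑ F inner) ⟨
  ((z₀ * 1ℝ * z₀ + ∑ F right) + ∑ F left) + ∑ F inner
    ≈⟨ +-cong (+-assoc (z₀ * 1ℝ * z₀) (∑ F right) (∑ F left)) ≈-refl ⟩
  (z₀ * 1ℝ * z₀ + (∑ F right + ∑ F left)) + ∑ F inner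
    ≈⟨ +-cong (+-cong ≈-refl (≈-sym (∑-+ F right left))) ≈-refl ⟩
  (z₀ * 1ℝ * z₀ + cross F z₀ x (z ∘ just)) + quad F X (z ∘ just) ∎
  where
  ≡⇒≈ : ∀ {a b} → a ≡ b → a ≈ b
  ≡⇒≈ refl = ≈-refl
  z₀ = z nothing
  row   = λ i → ∑ (finiteMaybe F) λ j → z i * bordered x X i j * z j
  right = λ i → z₀ * x i * z (just i)
  left  = λ i → z (just i) * x i * z₀
  inner = λ i → ∑ F λ j → z (just i) * X i j * z (just j)

∑± : (Sign → Sign → ℝ) → ℝ
∑± f = (f Sign.+ Sign.+ + f Sign.+ Sign.-) + (f Sign.- Sign.+ + f Sign.- Sign.-)

-- Collecting the four sign pairs over each pair of vertices reduces a comparison of forms to a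
-- polynomial identity in the entries of one 2×2 block.
quad-signed : ∀ {I} (F : Finite I) X (z : Vector (I × Sign)) →
  quad (finite× F finiteSign) X z
  ≈ ∑ F (λ i → ∑ F λ j → ∑± λ s r → z (i , s) * X (i , s) (j , r) * z (j , r))
quad-signed F X z = begin
  quad (finite× F finiteSign) X z
    ≈⟨ ∑-sign F _ ⟩
  ∑ F (λ i → row (i , Sign.+) + row (i , Sign.-))
    ≈⟨ ∑-cong F (λ i → ≈-trans
         (+-cong (∑-sign F (term (i , Sign.+))) (∑-sign F (term (i , Sign.-))))
         (≈-sym (∑-+ F (pair (i , Sign.+)) (pair (i , Sign.-))))) ⟩
  -- The bracketing of `∑±` makes this the required sum by definition.
  ∑ F (λ i → ∑ F λ j → pair (i , Sign.+) j + pair (i , Sign.-) j) ∎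
  where
  term = λ a b → z a * X a b * z b
  row  = λ a → ∑ (finite× F finiteSign) (term a)
  pair = λ a j → term a (j , Sign.+) + term a (j , Sign.-)

∑∑-cong : ∀ {I} (F : Finite I) {f g : I → I → ℝ} → (∀ i j → f i j ≈ g i j) →
  ∑ F (λ i → ∑ F (f i)) ≈ ∑ F (λ i → ∑ F (g i))
∑∑-cong F f≈g = ∑-cong F λ i → ∑-cong F (f≈g i)

∑∑-+ : ∀ {I} (F : Finite I) (f g : I → I → ℝ) →
  ∑ F (λ i → ∑ F λ j → f i j + g i j) ≈ ∑ F (λ i → ∑ F (f i)) + ∑ F (λ i → ∑ F (g i))
∑∑-+ F f g = ≈-trans (∑-cong F λ i → ∑-+ F (f i) (g i)) (∑-+ F _ _)

bordered-symmetric : ∀ {I} (x : Vector I) {X} → IsSymmetric X → IsSymmetric (bordered x X)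
bordered-symmetric x X-sym nothing  nothing  = ≈-refl
bordered-symmetric x X-sym nothing  (just j) = ≈-refl
bordered-symmetric x X-sym (just i) nothing  = ≈-refl
bordered-symmetric x X-sym (just i) (just j) = X-sym i j

-- A principal submatrix inherits nonnegativity: a test vector is extended by 0 in the border
-- coordinate, which kills the corner and the cross terms.
bordered-nonNeg⇒nonNeg : ∀ {I} (F : Finite I) x X →
  (∀ z → 0ℝ ≤ quad (finiteMaybe F) (bordered x X) z) → ∀ z → 0ℝ ≤ quad F X z
bordered-nonNeg⇒nonNeg {I} F x X nonNeg z = ≤-respʳ-≈ eq (nonNeg z⁺)
  where
  z⁺ : Vector (Maybe I)
  z⁺ nothing  = 0ℝ
  z⁺ (just i) = z i
  vanish : ∀ p q → 0ℚ ℚ.* p ℚ.* q ℚ.+ q ℚ.* p ℚ.* 0ℚ ≡ 0ℚ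
  vanish = solve 2 (λ p q → con 0ℚ :* p :* q :+ q :* p :* con 0ℚ := con 0ℚ) refl
  eq : quad (finiteMaybe F) (bordered x X) z⁺ ≈ quad F X z
  eq = begin
    quad (finiteMaybe F) (bordered x X) z⁺
      ≈⟨ quad-bordered F x X z⁺ ⟩
    (0ℝ * 1ℝ * 0ℝ + cross F 0ℝ x z) + quad F X z
      ≈⟨ +-cong (+-cong (pointwise λ _ → refl)
           (∑-zero F λ i → pointwise λ n → vanish (seq (x i) n) (seq (z i) n))) ≈-refl ⟩
    (0ℝ + 0ℝ) + quad F X z
      ≈⟨ +-cong (+-identityˡ 0ℝ) ≈-refl ⟩
    0ℝ + quad F X z
      ≈⟨ +-identityˡ (quad F X z) ⟩
    quad F X z ∎

-- Sums over a pair of signs and null entries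

∑±-cong : ∀ {f g} → (∀ s r → f s r ≈ g s r) → ∑± f ≈ ∑± g
∑±-cong f≈g = +-cong (+-cong (f≈g _ _) (f≈g _ _)) (+-cong (f≈g _ _) (f≈g _ _))

∑±-transpose : ∀ f → ∑± f ≈ ∑± (λ s r → f r s)
∑±-transpose f = +-interchange (f Sign.+ Sign.+) (f Sign.+ Sign.-) _ _

-- Conflict edges enter in this shape: a linear identity holds up to a multiple of two entries of
-- `X` that the edge forces to vanish.
drop-null : ∀ c {a b d e} → d ≈ 0ℝ → e ≈ 0ℝ → a ≈ b + c * (d + e) → a ≈ b
drop-null c {a} {b} {d} {e} d≈0 e≈0 a≈ = begin
  a                    ≈⟨ a≈ ⟩
  b + c * (d + e)      ≈⟨ +-cong ≈-refl (*-congˡ c (+-cong d≈0 e≈0)) ⟩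
  b + c * (0ℝ + 0ℝ)    ≈⟨ +-cong ≈-refl (pointwise λ n → ℚ.*-zeroʳ (seq c n)) ⟩
  b + 0ℝ               ≈⟨ +-identityʳ b ⟩
  b                    ∎

-- From signed theta bodies to certificates

symPart antiPart : ∀ {V} → Matrix (V × Sign) → Matrix V
symPart  X u v = ∑± λ s r → X (u , s) (v , r)
antiPart X u v = ∑± λ s r → ⟦ s ⟧ * X (u , s) (v , r) * ⟦ r ⟧

symPart-symmetric : ∀ {V} (X : Matrix (V × Sign)) → IsSymmetric X → IsSymmetric (symPart X)
symPart-symmetric X X-sym u v =
  ≈-trans (∑±-cong {λ s r → X (u , s) (v , r)} λ s r → X-sym (u , s) (v , r))
          (∑±-transpose λ s r → X (v , r) (u , s))

-- Symmetry of `X` leaves the factors `⟦ s ⟧` and `⟦ r ⟧` on the wrong sides, so each product is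
-- reversed before the sign pairs are transposed.
antiPart-symmetric : ∀ {V} (X : Matrix (V × Sign)) → IsSymmetric X → IsSymmetric (antiPart X)
antiPart-symmetric X X-sym u v = ≈-trans
  (∑±-cong {λ s r → ⟦ s ⟧ * X (u , s) (v , r) * ⟦ r ⟧} λ s r →
    ≈-trans (*-congʳ ⟦ r ⟧ (*-congˡ ⟦ s ⟧ (X-sym (u , s) (v , r))))
            (reverse ⟦ s ⟧ (X (v , r) (u , s)) ⟦ r ⟧))
  (∑±-transpose λ s r → ⟦ r ⟧ * X (v , r) (u , s) * ⟦ s ⟧)
  where
  reverse : ∀ a b c → a * b * c ≈ c * b * a
  reverse a b c = pointwise λ n → solve 3 (λ a b c → a :* b :* c := c :* b :* a) refl
    (seq a n) (seq b n) (seq c n)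

module _ {V} (F : Finite V) (X : Matrix (V × Sign)) where

  -- The form of `X` is evaluated at a vector that ignores the sign coordinate. Its inner part sums
  -- each block of `X`, and its border sums `y` over the signs, giving `x`.
  bordered-symPart-nonNeg : ∀ y x → (∀ v → foldSigns y v ≈ x v) →
    (∀ z → 0ℝ ≤ quad (finiteMaybe (finite× F finiteSign)) (bordered y X) z) →
    ∀ z → 0ℝ ≤ quad (finiteMaybe F) (bordered x (symPart X)) z
  bordered-symPart-nonNeg y x fold≈x nonNeg z = ≤-respʳ-≈ eq (nonNeg z±)
    where
    z± : Vector (Maybe (V × Sign))
    z± nothing        = z nothing
    z± (just (v , _)) = z (just v)
    z₀ = z nothing
    linear : ∀ v → (z₀ * y (v , Sign.+) * z (just v) + z (just v) * y (v , Sign.+) * z₀)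
                 + (z₀ * y (v , Sign.-) * z (just v) + z (just v) * y (v , Sign.-) * z₀)
                 ≈ z₀ * x v * z (just v) + z (just v) * x v * z₀
    linear v = ≈-trans
      (pointwise λ n → solve 4
        (λ a b c d → (a :* b :* d :+ d :* b :* a) :+ (a :* c :* d :+ d :* c :* a)
                  := a :* (b :+ c) :* d :+ d :* (b :+ c) :* a) refl
        (seq z₀ n) (seq (y (v , Sign.+)) n) (seq (y (v , Sign.-)) n) (seq (z (just v)) n))
      (+-cong (*-congʳ (z (just v)) (*-congˡ z₀ (fold≈x v)))
              (*-congʳ z₀ (*-congˡ (z (just v)) (fold≈x v))))
    quadratic : ∀ u v → ∑± (λ s r → z (just u) * X (u , s) (v , r) * z (just v))
                      ≈ z (just u) * symPart X u v * z (just v)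
    quadratic u v = pointwise λ n → solve 6
      (λ a p q r s b → (a :* p :* b :+ a :* q :* b) :+ (a :* r :* b :+ a :* s :* b)
                    := a :* ((p :+ q) :+ (r :+ s)) :* b) refl
      (seq (z (just u)) n)
      (seq (X (u , Sign.+) (v , Sign.+)) n) (seq (X (u , Sign.+) (v , Sign.-)) n)
      (seq (X (u , Sign.-) (v , Sign.+)) n) (seq (X (u , Sign.-) (v , Sign.-)) n)
      (seq (z (just v)) n)
    eq : quad (finiteMaybe (finite× F finiteSign)) (bordered y X) z±
       ≈ quad (finiteMaybe F) (bordered x (symPart X)) z
    eq = begin
      quad (finiteMaybe (finite× F finiteSign)) (bordered y X) z±
        ≈⟨ quad-bordered (finite× F finiteSign) y X z± ⟩
      (z₀ * 1ℝ * z₀ + cross (finite× F finiteSign) z₀ y (z± ∘ just))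
        + quad (finite× F finiteSign) X (z± ∘ just)
        ≈⟨ +-cong (+-cong ≈-refl (≈-trans (∑-sign F _) (∑-cong F linear)))
                  (≈-trans (quad-signed F X (z± ∘ just)) (∑∑-cong F quadratic)) ⟩
      (z₀ * 1ℝ * z₀ + cross F z₀ x (z ∘ just)) + quad F (symPart X) (z ∘ just)
        ≈⟨ quad-bordered F x (symPart X) z ⟨
      quad (finiteMaybe F) (bordered x (symPart X)) z ∎

  -- The form of `X` is evaluated at the alternating vector `z v * ⟦ s ⟧`, whose signs become the
  -- factors in `antiPart`.
  antiPart-nonNeg :
    (∀ z → 0ℝ ≤ quad (finite× F finiteSign) X z) → ∀ z → 0ℝ ≤ quad F (antiPart X) z
  antiPart-nonNeg nonNeg z = ≤-respʳ-≈
    (≈-trans (quad-signed F X z±) (∑∑-cong F quadratic)) (nonNeg z±)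
    where
    z± : Vector (V × Sign)
    z± (v , s) = z v * ⟦ s ⟧
    quadratic : ∀ u v → ∑± (λ s r → z± (u , s) * X (u , s) (v , r) * z± (v , r))
                      ≈ z u * antiPart X u v * z v
    quadratic u v = pointwise λ n → solve 6
      (λ a p q r s b → let + = con 1ℚ ; - = :- con 1ℚ in
           ((a :* +) :* p :* (b :* +) :+ (a :* +) :* q :* (b :* -))
        :+ ((a :* -) :* r :* (b :* +) :+ (a :* -) :* s :* (b :* -))
        := a :* ((+ :* p :* + :+ + :* q :* -) :+ (- :* r :* + :+ - :* s :* -)) :* b) refl
      (seq (z u) n)
      (seq (X (u , Sign.+) (v , Sign.+)) n) (seq (X (u , Sign.+) (v , Sign.-)) n)
      (seq (X (u , Sign.-) (v , Sign.+)) n) (seq (X (u , Sign.-) (v , Sign.-)) n)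
      (seq (z v) n)

module _ {V} (X : Matrix (V × Sign)) where

  -- For `t = +` the difference of the two sides is -2 times the sum of the entries with unequal
  -- signs. For `t = -` it is 2 times the sum of those with equal signs. These are the entries
  -- assumed null.
  parts-edge : ∀ t {u v} → (∀ s → X (u , s) (v , opposite t Sign.* s) ≈ 0ℝ) →
    antiPart X u v ≈ ⟦ t ⟧ * symPart X u v
  parts-edge Sign.+ {u} {v} zero = drop-null (- (1ℝ + 1ℝ)) (zero Sign.+) (zero Sign.-)
    (pointwise λ n → solve 4
      (λ p q r s → let + = con 1ℚ ; - = :- con 1ℚ in
        (+ :* p :* + :+ + :* q :* -) :+ (- :* r :* + :+ - :* s :* -)
        := + :* ((p :+ q) :+ (r :+ s)) :+ (:- (+ :+ +)) :* (q :+ r)) refl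
      (seq (X (u , Sign.+) (v , Sign.+)) n) (seq (X (u , Sign.+) (v , Sign.-)) n)
      (seq (X (u , Sign.-) (v , Sign.+)) n) (seq (X (u , Sign.-) (v , Sign.-)) n))
  parts-edge Sign.- {u} {v} zero = drop-null (1ℝ + 1ℝ) (zero Sign.+) (zero Sign.-)
    (pointwise λ n → solve 4
      (λ p q r s → let + = con 1ℚ ; - = :- con 1ℚ in
        (+ :* p :* + :+ + :* q :* -) :+ (- :* r :* + :+ - :* s :* -)
        := - :* ((p :+ q) :+ (r :+ s)) :+ (+ :+ +) :* (p :+ s)) refl
      (seq (X (u , Sign.+) (v , Sign.+)) n) (seq (X (u , Sign.+) (v , Sign.-)) n)
      (seq (X (u , Sign.-) (v , Sign.+)) n) (seq (X (u , Sign.-) (v , Sign.-)) n))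

  symPart-loop : ∀ {v} → (∀ s → X (v , s) (v , opposite s) ≈ 0ℝ) →
    symPart X v v ≈ X (v , Sign.+) (v , Sign.+) + X (v , Sign.-) (v , Sign.-)
  symPart-loop zero = +-cong
    (≈-trans (+-cong ≈-refl (zero Sign.+)) (+-identityʳ _))
    (≈-trans (+-cong (zero Sign.-) ≈-refl) (+-identityˡ _))

module _ (S : SignedGraph) {x : Vector (SignedGraph.Vertex S)} where
  open SignedGraph S

  BTH⇒certificate : x ∈ BTH (completion S) →
    ∃[ M ] ∃[ N ] IsCertificate (completion S) x M N
  BTH⇒certificate (y , (X , X-sym , (_ , nonNeg) , X-diag , X-edge) , fold≈x) =
    symPart X , antiPart X , record
      { M-symmetric  = M-sym
      ; N-symmetric  = N-sym
      ; M-psd        = bordered-symmetric x M-sym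
                     , bordered-symPart-nonNeg F X y x fold≈x nonNeg
      ; N-psd        = N-sym
                     , antiPart-nonNeg F X
                         (bordered-nonNeg⇒nonNeg (finite× F finiteSign) y X nonNeg)
      ; M-diagonal   = M-diag
      -- The loop added at `v` is a positive edge, so the edge relation equates the two diagonals.
      ; N-diagonal   = λ v → begin
          antiPart X v v      ≈⟨ edge (inj₂ v) v v (inj₁ (refl , refl)) ⟩
          1ℝ * symPart X v v  ≈⟨ *-identityˡ (symPart X v v) ⟩
          symPart X v v       ≈⟨ M-diag v ⟩
          x v                 ∎
      ; edgeRelation = edge
      }
    where
    F = finiteVertex
    M-sym = symPart-symmetric X X-sym
    N-sym = antiPart-symmetric X X-sym
    -- The added loop makes `(v , +)` and `(v , -)` adjacent, so only the diagonal of the block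
    -- survives, and it carries the two values of `y`.
    M-diag : ∀ v → symPart X v v ≈ x v
    M-diag v = begin
      symPart X v v
        ≈⟨ symPart-loop X (λ s → X-edge _ _ (inj₂ v , inj₁ (refl , refl) , refl)) ⟩
      X (v , Sign.+) (v , Sign.+) + X (v , Sign.-) (v , Sign.-)
        ≈⟨ +-cong (X-diag _) (X-diag _) ⟩
      foldSigns y v
        ≈⟨ fold≈x v ⟩
      x v ∎
    edge : ∀ e u v → SignedGraph.Joins (completion S) e u v →
      antiPart X u v ≈ ⟦ SignedGraph.σ (completion S) e ⟧ * symPart X u v
    edge e u v J = parts-edge X (SignedGraph.σ (completion S) e)
      λ s → X-edge _ _ (e , J , refl)

-- From certificates to signed theta bodies

halve : ∀ {V} → Vector V → Vector (V × Sign)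
halve x (v , _) = fromℚ ½ * x v

-- The inverse of the passage to parts: up to `≈`, `symPart` and `antiPart` of the blend are `M` and
-- `N`, the quarter undoing the sum over four sign pairs. The product is taken in `Sign` so that
-- sign laws can rewrite the coefficient.
blend : ∀ {V} → Matrix V → Matrix V → Matrix (V × Sign)
blend M N (u , s) (v , r) = fromℚ (½ ℚ.* ½) * (M u v + ⟦ s Sign.* r ⟧ * N u v)

blend-symmetric : ∀ {V} {M N : Matrix V} → IsSymmetric M → IsSymmetric N →
  IsSymmetric (blend M N)
blend-symmetric {N = N} M-sym N-sym (u , s) (v , r)
  rewrite Sign.*-comm s r =
  *-congˡ _ (+-cong (M-sym u v) (*-congˡ ⟦ r Sign.* s ⟧ (N-sym u v)))

-- The sign product s · (-t · s) equals -t, so the entry is a quarter of `M u v` minus t · t times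
-- `M u v`.
blend-edge : ∀ {V} (M N : Matrix V) t s {u v} → N u v ≈ ⟦ t ⟧ * M u v →
  blend M N (u , s) (v , opposite t Sign.* s) ≈ 0ℝ
blend-edge M N t s {u} {v} N≈tM = ≈-trans
  (*-congˡ _ (+-cong ≈-refl (*-congˡ ⟦ s Sign.* (opposite t Sign.* s) ⟧ N≈tM)))
  (cancel t s)
  where
  cancel⁺ : ∀ m → ½ ℚ.* ½ ℚ.* (m ℚ.+ (ℚ.- 1ℚ) ℚ.* (1ℚ ℚ.* m)) ≡ 0ℚ
  cancel⁺ = solve 1
    (λ m → con ½ :* con ½ :* (m :+ (:- con 1ℚ) :* (con 1ℚ :* m)) := con 0ℚ) refl
  cancel⁻ : ∀ m → ½ ℚ.* ½ ℚ.* (m ℚ.+ 1ℚ ℚ.* ((ℚ.- 1ℚ) ℚ.* m)) ≡ 0ℚ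
  cancel⁻ = solve 1
    (λ m → con ½ :* con ½ :* (m :+ con 1ℚ :* ((:- con 1ℚ) :* m)) := con 0ℚ) refl
  cancel : ∀ t s →
    fromℚ (½ ℚ.* ½) * (M u v + ⟦ s Sign.* (opposite t Sign.* s) ⟧ * (⟦ t ⟧ * M u v)) ≈ 0ℝ
  -- Once both signs are known the coefficient computes, and it depends on `t` alone.
  cancel Sign.+ Sign.+ = pointwise λ n → cancel⁺ (seq (M u v) n)
  cancel Sign.+ Sign.- = pointwise λ n → cancel⁺ (seq (M u v) n)
  cancel Sign.- Sign.+ = pointwise λ n → cancel⁻ (seq (M u v) n)
  cancel Sign.- Sign.- = pointwise λ n → cancel⁻ (seq (M u v) n)

blend-diagonal : ∀ {V} (M N : Matrix V) {x : Vector V} {v} s →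
  M v v ≈ x v → N v v ≈ x v → blend M N (v , s) (v , s) ≈ halve x (v , s)
blend-diagonal M N {x} {v} s M≈x N≈x rewrite Sign.s*s≡+ s = ≈-trans
  (*-congˡ _ (+-cong M≈x (*-congˡ 1ℝ N≈x)))
  (pointwise λ n → solve 1
    (λ x → con ½ :* con ½ :* (x :+ con 1ℚ :* x) := con ½ :* x) refl (seq (x v) n))

-- Per sign block the all-ones and alternating directions decouple: `M` meets only the even part of
-- `z` and `N` only the odd part. The border is constant in the sign, so it joins the form of `M`.
blend-nonNeg : ∀ {V} (F : Finite V) (x : Vector V) M N →
  (∀ z → 0ℝ ≤ quad (finiteMaybe F) (bordered x M) z) → (∀ z → 0ℝ ≤ quad F N z) →
  ∀ z → 0ℝ ≤ quad (finiteMaybe (finite× F finiteSign)) (bordered (halve x) (blend M N)) z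
blend-nonNeg {V} F x M N M≥0 N≥0 z = ≤-respʳ-≈ eq (0≤+ (M≥0 even) (N≥0 odd))
  where
  z₀ = z nothing
  z₊ z₋ odd : Vector V
  z₊ v  = z (just (v , Sign.+))
  z₋ v  = z (just (v , Sign.-))
  odd v = fromℚ ½ * (z₊ v + - z₋ v)
  even : Vector (Maybe V)
  -- The border coordinate stays unscaled: the factor ½ of `halve x` in the cross terms is matched
  -- by the ½ in the other coordinates of `even`.
  even nothing  = z₀
  even (just v) = fromℚ ½ * (z₊ v + z₋ v)
  linear : ∀ v → z₀ * x v * even (just v) + even (just v) * x v * z₀
               ≈ (z₀ * halve x (v , Sign.+) * z₊ v + z₊ v * halve x (v , Sign.+) * z₀)
               + (z₀ * halve x (v , Sign.-) * z₋ v + z₋ v * halve x (v , Sign.-) * z₀)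
  linear v = pointwise λ n → solve 4
    (λ a x p q → let h = con ½ in
       a :* x :* (h :* (p :+ q)) :+ (h :* (p :+ q)) :* x :* a
       := (a :* (h :* x) :* p :+ p :* (h :* x) :* a)
       :+ (a :* (h :* x) :* q :+ q :* (h :* x) :* a)) refl
    (seq z₀ n) (seq (x v) n) (seq (z₊ v) n) (seq (z₋ v) n)
  quadratic : ∀ u v →
    even (just u) * M u v * even (just v) + odd u * N u v * odd v
    ≈ ∑± (λ s r → z (just (u , s)) * blend M N (u , s) (v , r) * z (just (v , r)))
  quadratic u v = pointwise λ n → solve 6
    (λ m k a b c d →
       let h = con ½ ; q = h :* h
           + = q :* (m :+ con 1ℚ :* k) ; - = q :* (m :+ (:- con 1ℚ) :* k)
       in (h :* (a :+ b)) :* m :* (h :* (c :+ d)) :+ (h :* (a :+ :- b)) :* k :* (h :* (c :+ :- d))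
       := (a :* + :* c :+ a :* - :* d) :+ (b :* - :* c :+ b :* + :* d)) refl
    (seq (M u v) n) (seq (N u v) n)
    (seq (z₊ u) n) (seq (z₋ u) n) (seq (z₊ v) n) (seq (z₋ v) n)
  eq : quad (finiteMaybe F) (bordered x M) even + quad F N odd
     ≈ quad (finiteMaybe (finite× F finiteSign)) (bordered (halve x) (blend M N)) z
  eq = begin
    quad (finiteMaybe F) (bordered x M) even + quad F N odd
      ≈⟨ +-cong (quad-bordered F x M even) ≈-refl ⟩
    ((z₀ * 1ℝ * z₀ + cross F z₀ x (even ∘ just)) + quad F M (even ∘ just)) + quad F N odd
      ≈⟨ +-assoc _ (quad F M (even ∘ just)) (quad F N odd) ⟩
    (z₀ * 1ℝ * z₀ + cross F z₀ x (even ∘ just)) + (quad F M (even ∘ just) + quad F N odd)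
      ≈⟨ +-cong
           (+-cong ≈-refl (≈-trans (∑-cong F linear) (≈-sym (∑-sign F _))))
           (≈-trans (≈-sym (∑∑-+ F _ _))
             (≈-trans (∑∑-cong F quadratic) (≈-sym (quad-signed F (blend M N) (z ∘ just))))) ⟩
    (z₀ * 1ℝ * z₀ + cross (finite× F finiteSign) z₀ (halve x) (z ∘ just))
      + quad (finite× F finiteSign) (blend M N) (z ∘ just)
      ≈⟨ quad-bordered (finite× F finiteSign) (halve x) (blend M N) z ⟨
    quad (finiteMaybe (finite× F finiteSign)) (bordered (halve x) (blend M N)) z ∎

certificate⇒BTH : ∀ S {x M N} → IsCertificate S x M N → x ∈ BTH S
certificate⇒BTH S {x} {M} {N} cert =
  halve x
  , (blend M N , X-sym
    , (bordered-symmetric (halve x) X-sym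
      , blend-nonNeg finiteVertex x M N (proj₂ M-psd) (proj₂ N-psd))
    , (λ (v , s) → blend-diagonal M N {x} s (M-diagonal v) (N-diagonal v))
    -- Matching on `refl` turns the second sign into `opposite (σ e) * s`, the shape `blend-edge`
    -- expects.
    , λ { (u , s) (v , _) (e , J , refl) → blend-edge M N (σ e) s (edgeRelation e u v J) })
  , λ v → pointwise λ n → ½+½ (seq (x v) n)
  where
  open SignedGraph S
  open IsCertificate cert
  X-sym = blend-symmetric M-symmetric N-symmetric

-- Digons and the final equivalence

-- The two edges give `N u v` equal to both `M u v` and its negative. Averaging these equations
-- yields 0 for `N u v`, and the positive edge carries this over to `M u v`.
digon⇒zero : ∀ S {x M N} → IsCertificate S x M N →
  ∀ u v → Digon S u v → M u v ≈ 0ℝ × N u v ≈ 0ℝ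
digon⇒zero S {M = M} {N} cert u v ((e , J , σe≡+) , (f , K , σf≡-)) = M≈0 , N≈0
  where
  open IsCertificate cert
  N≈M : N u v ≈ 1ℝ * M u v
  N≈M = subst (λ t → N u v ≈ ⟦ t ⟧ * M u v) σe≡+ (edgeRelation e u v J)
  N≈-M : N u v ≈ - 1ℝ * M u v
  N≈-M = subst (λ t → N u v ≈ ⟦ t ⟧ * M u v) σf≡- (edgeRelation f u v K)
  N≈0 : N u v ≈ 0ℝ
  N≈0 = begin
    N u v
      ≈⟨ pointwise (λ n → ½+½ (seq (N u v) n)) ⟨
    fromℚ ½ * N u v + fromℚ ½ * N u v
      ≈⟨ +-cong (*-congˡ _ N≈M) (*-congˡ _ N≈-M) ⟩
    fromℚ ½ * (1ℝ * M u v) + fromℚ ½ * (- 1ℝ * M u v)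
      ≈⟨ pointwise (λ n → solve 1
           (λ m → con ½ :* (con 1ℚ :* m) :+ con ½ :* ((:- con 1ℚ) :* m) := con 0ℚ) refl
           (seq (M u v) n)) ⟩
    0ℝ ∎
  M≈0 : M u v ≈ 0ℝ
  M≈0 = ≈-trans (≈-sym (*-identityˡ (M u v))) (≈-trans (≈-sym N≈M) N≈0)

theorem7p2 : (S : SignedGraph) (x : Vector (SignedGraph.Vertex S)) →
    (x ∈ BTH (completion S)
    ⇔ (∃[ M ] ∃[ N ] IsCertificate (completion S) x M N))
    × (∀ M N → IsCertificate (completion S) x M N →
    ∀ u v → Digon (completion S) u v → M u v ≈ 0ℝ × N u v ≈ 0ℝ)
theorem7p2 S x =
  mk⇔ (BTH⇒certificate S) (λ (M , N , cert) → certificate⇒BTH (completion S) cert)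
  , λ M N cert → digon⇒zero (completion S) cert
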